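{- Let $V$ be a finite-dimensional representation of a group $G$ over a field $k$. The set of Lie elements $\mathcal{L}(V)\subset k[G]$ is a Lie subalgebra of $k[G]$, where $k[G]$ carries the commutator bracket $[p,q]=pq-qp$.
   Context: For $g\in G$ and $m\ge 1$ define linear operators $\mathcal{G}_m\langle g\rangle,\mathcal{A}_m\langle g\rangle$ on the exterior power $V^{\wedge m}$ by $$\mathcal{G}_m\langle g\rangle(v_1\wedge\dots\wedge v_m)=g(v_1)\wedge\dots\wedge g(v_m),$$ $$\mathcal{A}_m\langle g\rangle(v_1\wedge\dots\wedge v_m)=\sum_{p=1}^m v_1\wedge\dots\wedge g(v_p)\wedge\dots\wedge v_m,$$ and for $m=0$ (with $V^{\wedge 0}=k$) put $\mathcal{G}_0\langle g\rangle=\mathrm{Id}$, $\mathcal{A}_0\langle g\rangle=0$. Extend $\mathcal{G}_m,\mathcal{A}_m$ by linearity to maps $k[G]\to\mathrm{End}(V^{\wedge m})$ on the group algebra. An element $x\in k[G]$ is a Lie element (with respect to $V$) if $\mathcal{G}_m\langle x\rangle=\mathcal{A}_m\langle x\rangle$ for all $m=0,1,\dots,\dim V$. The set of Lie elements is $\mathcal{L}(V)\subset k[G]$. -}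

module Defs where

open import Level using (Level; _⊔_) renaming (suc to lsuc)
open import Algebra.Apartness.Bundles using (HeytingField; HeytingCommutativeRing)
open import Algebra.Bundles using (CommutativeRing; Group; RawMonoid; Ring)
open import Algebra.Core using (Op₂)
open import Algebra.Definitions.RawMonoid using (sum)
open import Algebra.Module.Bundles using (LeftModule)
open import Algebra.Module.Morphism.Structures using (module LeftModuleMorphisms)
open import Algebra.Morphism.Structures using (module MonoidMorphisms)
open import Algebra.Structures using (IsRing)
import Algebra.Module.Properties.LeftModule as LeftModuleProperties
import Algebra.Properties.AbelianGroup as AbelianGroupProperties
import Algebra.Properties.CommutativeMonoid.Sum as SumProperties
import Algebra.Properties.Ring as RingProperties
import Algebra.Solver.CommutativeMonoid as CommutativeMonoidSolver
open import Data.Fin.Base using (Fin; zero; suc)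
open import Data.Fin.Properties using (_≟_; suc-injective)
open import Data.Nat.Base using (ℕ; _≤_)
open import Data.Product.Base using (_,_; ∃-syntax)
open import Data.Vec.Functional using (Vector; updateAt)
open import Data.Vec.Functional.Properties
  using (updateAt-updates; updateAt-minimal; updateAt-updateAt; updateAt-commutes; map-updateAt)
open import Function.Base using (const; _∘_)
open import Relation.Binary.Core using (Rel)
open import Relation.Binary.Definitions using (_Respects_)
open import Relation.Binary.PropositionalEquality as ≡ using (_≡_; _≢_)
import Relation.Binary.Reasoning.Setoid as SetoidReasoning
open import Relation.Nullary.Decidable.Core using (yes; no)
open import Relation.Nullary.Negation.Core using (contradiction)
open import Relation.Unary using (Pred)

infixl 5 _[_]≔_

_[_]≔_ : ∀ {a n} {A : Set a} → Vector A n → Fin n → A → Vector A n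
v [ i ]≔ x = updateAt v i (const x)

module _ {c ℓ₁ ℓ₂ : Level} (K : HeytingField c ℓ₁ ℓ₂) where

  -- In a Heyting field x # y means that x - y is invertible, and x ≈ y means
  -- ¬ (x # y); classically this is exactly a field.
  private
    scalars : CommutativeRing c ℓ₁
    scalars = HeytingCommutativeRing.commutativeRing (HeytingField.heytingCommutativeRing K)

    module K = CommutativeRing scalars

  VectorSpace : (v ℓv : Level) → Set (c ⊔ ℓ₁ ⊔ lsuc (v ⊔ ℓv))
  VectorSpace v ℓv = LeftModule K.ring v ℓv

  record LinearMap {a ℓa b ℓb : Level} (A : VectorSpace a ℓa) (B : VectorSpace b ℓb)
                   : Set (c ⊔ a ⊔ ℓa ⊔ b ⊔ ℓb) where
    private
      module A = LeftModule A
      module B = LeftModule B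
    open LeftModuleMorphisms A.rawLeftModule B.rawLeftModule
    infixr 9 _⟨$⟩_
    field
      _⟨$⟩_                    : A.Carrierᴹ → B.Carrierᴹ
      isLeftModuleHomomorphism : IsLeftModuleHomomorphism _⟨$⟩_
    open IsLeftModuleHomomorphism isLeftModuleHomomorphism public

  open LinearMap using (_⟨$⟩_)

  module _ {a ℓa b ℓb : Level} {A : VectorSpace a ℓa} {B : VectorSpace b ℓb} where
    private
      module A = LeftModule A
      module B = LeftModule B

    linearMap : (f : A.Carrierᴹ → B.Carrierᴹ) →
                (∀ {x y} → x A.≈ᴹ y → f x B.≈ᴹ f y) →
                (∀ x y → f (x A.+ᴹ y) B.≈ᴹ f x B.+ᴹ f y) →
                (∀ r x → f (r A.*ₗ x) B.≈ᴹ r B.*ₗ f x) →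
                LinearMap A B
    linearMap f f-cong f-+ f-* = record
      { _⟨$⟩_                    = f
      ; isLeftModuleHomomorphism = record
        { +ᴹ-isGroupHomomorphism = record
          { isMonoidHomomorphism = record
            { isMagmaHomomorphism = record
              { isRelHomomorphism = record { cong = f-cong }
              ; homo              = f-+
              }
            ; ε-homo              = f-0
            }
          ; ⁻¹-homo              = f-neg
          }
        ; *ₗ-homo                = f-*
        }
      }
      where
      open SetoidReasoning B.≈ᴹ-setoid
      f-0 : f A.0ᴹ B.≈ᴹ B.0ᴹ
      f-0 = begin
        f A.0ᴹ               ≈⟨ f-cong (A.*ₗ-zeroˡ A.0ᴹ) ⟨
        f (K.0# A.*ₗ A.0ᴹ)   ≈⟨ f-* K.0# A.0ᴹ ⟩
        K.0# B.*ₗ f A.0ᴹ     ≈⟨ B.*ₗ-zeroˡ _ ⟩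
        B.0ᴹ                 ∎
      f-neg : ∀ x → f (A.-ᴹ x) B.≈ᴹ B.-ᴹ f x
      f-neg x = LeftModuleProperties.inverseˡ-uniqueᴹ B (f (A.-ᴹ x)) (f x) (begin
        f (A.-ᴹ x) B.+ᴹ f x  ≈⟨ f-+ (A.-ᴹ x) x ⟨
        f (A.-ᴹ x A.+ᴹ x)    ≈⟨ f-cong (A.-ᴹ‿inverseˡ x) ⟩
        f A.0ᴹ               ≈⟨ f-0 ⟩
        B.0ᴹ                 ∎)

  module _ {a ℓa : Level} (A : VectorSpace a ℓa) where
    private
      module A = LeftModule A
      open A using (≈ᴹ-refl; ≈ᴹ-sym; ≈ᴹ-trans)

    infix 4 _≈ᴱ_
    _≈ᴱ_ : Rel (LinearMap A A) (a ⊔ ℓa)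
    S ≈ᴱ T = ∀ x → S ⟨$⟩ x A.≈ᴹ T ⟨$⟩ x

    private
      open AbelianGroupProperties A.+ᴹ-abelianGroup using (⁻¹-∙-comm)
      open CommutativeMonoidSolver A.+ᴹ-commutativeMonoid using (solve; _⊕_; _⊜_)

      idᴱ 0ᴱ : LinearMap A A
      idᴱ = linearMap (λ x → x) (λ p → p) (λ _ _ → ≈ᴹ-refl) (λ _ _ → ≈ᴹ-refl)
      0ᴱ  = linearMap (λ _ → A.0ᴹ) (λ _ → ≈ᴹ-refl)
                      (λ _ _ → ≈ᴹ-sym (A.+ᴹ-identityˡ _)) (λ r _ → ≈ᴹ-sym (A.*ₗ-zeroʳ r))

      _∘ᴱ_ _+ᴱ_ : LinearMap A A → LinearMap A A → LinearMap A A
      S ∘ᴱ T = linearMap (λ x → S ⟨$⟩ (T ⟨$⟩ x)) (λ p → S.⟦⟧-cong (T.⟦⟧-cong p))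
                 (λ x y → ≈ᴹ-trans (S.⟦⟧-cong (T.+ᴹ-homo x y)) (S.+ᴹ-homo _ _))
                 (λ r x → ≈ᴹ-trans (S.⟦⟧-cong (T.*ₗ-homo r x)) (S.*ₗ-homo r _))
        where
        module S = LinearMap S
        module T = LinearMap T
      S +ᴱ T = linearMap (λ x → S ⟨$⟩ x A.+ᴹ T ⟨$⟩ x)
                 (λ p → A.+ᴹ-cong (S.⟦⟧-cong p) (T.⟦⟧-cong p))
                 (λ x y → ≈ᴹ-trans (A.+ᴹ-cong (S.+ᴹ-homo x y) (T.+ᴹ-homo x y))
                            (solve 4 (λ p q s t → (p ⊕ q) ⊕ (s ⊕ t) ⊜ (p ⊕ s) ⊕ (q ⊕ t)) ≈ᴹ-refl _ _ _ _))
                 (λ r x → ≈ᴹ-trans (A.+ᴹ-cong (S.*ₗ-homo r x) (T.*ₗ-homo r x))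
                            (≈ᴹ-sym (A.*ₗ-distribˡ r _ _)))
        where
        module S = LinearMap S
        module T = LinearMap T

      _*ᴱ_ : K.Carrier → LinearMap A A → LinearMap A A
      s *ᴱ T = linearMap (λ x → s A.*ₗ (T ⟨$⟩ x)) (λ p → A.*ₗ-congˡ (T.⟦⟧-cong p))
                 (λ x y → ≈ᴹ-trans (A.*ₗ-congˡ (T.+ᴹ-homo x y)) (A.*ₗ-distribˡ s _ _))
                 (λ r x → ≈ᴹ-trans (A.*ₗ-congˡ (T.*ₗ-homo r x))
                            (≈ᴹ-trans (≈ᴹ-sym (A.*ₗ-assoc s r _))
                              (≈ᴹ-trans (A.*ₗ-congʳ (K.*-comm s r)) (A.*ₗ-assoc r s _))))
        where module T = LinearMap T

      -ᴱ_ : LinearMap A A → LinearMap A A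
      -ᴱ T = linearMap (λ x → A.-ᴹ (T ⟨$⟩ x)) (λ p → A.-ᴹ‿cong (T.⟦⟧-cong p))
               (λ x y → ≈ᴹ-trans (A.-ᴹ‿cong (T.+ᴹ-homo x y)) (≈ᴹ-sym (⁻¹-∙-comm _ _)))
               (λ r x → ≈ᴹ-trans (A.-ᴹ‿cong (T.*ₗ-homo r x))
                          (≈ᴹ-sym (LeftModuleProperties.inverseˡ-uniqueᴹ A _ _
                            (≈ᴹ-trans (≈ᴹ-sym (A.*ₗ-distribˡ r _ _))
                              (≈ᴹ-trans (A.*ₗ-congˡ (A.-ᴹ‿inverseˡ _)) (A.*ₗ-zeroʳ r))))))
        where module T = LinearMap T

    End : VectorSpace (c ⊔ a ⊔ ℓa) (a ⊔ ℓa)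
    End = record
      { Carrierᴹ     = LinearMap A A
      ; _≈ᴹ_         = _≈ᴱ_
      ; _+ᴹ_         = _+ᴱ_
      ; _*ₗ_         = _*ᴱ_
      ; 0ᴹ           = 0ᴱ
      ; -ᴹ_          = -ᴱ_
      ; isLeftModule = record
        { isLeftSemimodule = record
          { +ᴹ-isCommutativeMonoid = record
            { isMonoid = record
              { isSemigroup = record
                { isMagma = record
                  { isEquivalence = record
                    { refl  = λ _ → ≈ᴹ-refl
                    ; sym   = λ p x → ≈ᴹ-sym (p x)
                    ; trans = λ p q x → ≈ᴹ-trans (p x) (q x)
                    }
                  ; ∙-cong = λ p q x → A.+ᴹ-cong (p x) (q x)
                  }
                ; assoc = λ S T U x → A.+ᴹ-assoc _ _ _
                }
              ; identity = (λ T x → A.+ᴹ-identityˡ _) , (λ T x → A.+ᴹ-identityʳ _)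
              }
            ; comm = λ S T x → A.+ᴹ-comm _ _
            }
          ; isPreleftSemimodule = record
            { *ₗ-cong      = λ p q x → A.*ₗ-cong p (q x)
            ; *ₗ-zeroˡ     = λ T x → A.*ₗ-zeroˡ _
            ; *ₗ-distribʳ  = λ T r s x → A.*ₗ-distribʳ _ r s
            ; *ₗ-identityˡ = λ T x → A.*ₗ-identityˡ _
            ; *ₗ-assoc     = λ r s T x → A.*ₗ-assoc r s _
            ; *ₗ-zeroʳ     = λ r x → A.*ₗ-zeroʳ r
            ; *ₗ-distribˡ  = λ r S T x → A.*ₗ-distribˡ r _ _
            }
          }
        ; -ᴹ‿cong    = λ p x → A.-ᴹ‿cong (p x)
        ; -ᴹ‿inverse = (λ T x → A.-ᴹ‿inverseˡ _) , (λ T x → A.-ᴹ‿inverseʳ _)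
        }
      }

    End-rawMonoid : RawMonoid (c ⊔ a ⊔ ℓa) (a ⊔ ℓa)
    End-rawMonoid = record { Carrier = LinearMap A A ; _≈_ = _≈ᴱ_ ; _∙_ = _∘ᴱ_ ; ε = idᴱ }

  record FiniteDimensional {v ℓv : Level} (V : VectorSpace v ℓv) : Set (c ⊔ ℓ₁ ⊔ v ⊔ ℓv) where
    open LeftModule V
    field
      dim   : ℕ
      basis : Vector Carrierᴹ dim

    combination : Vector K.Carrier dim → Carrierᴹ
    combination a = sum +ᴹ-rawMonoid (λ i → a i *ₗ basis i)

    field
      spanning    : ∀ x → ∃[ a ] x ≈ᴹ combination a
      independent : ∀ a → combination a ≈ᴹ 0ᴹ → ∀ i → a i K.≈ K.0#

  -- `Presented _∼_` is the vector space with generators X and relations _∼_: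
  -- formal linear combinations modulo the least linear congruence containing _∼_.
  infixl 6 _⊹_
  infixr 7 _·_

  data Term {x : Level} (X : Set x) : Set (c ⊔ x) where
    gen : X → Term X
    𝟘   : Term X
    _⊹_ : Term X → Term X → Term X
    _·_ : K.Carrier → Term X → Term X

  module _ {x ρ : Level} {X : Set x} (_∼_ : Rel (Term X) ρ) where

    infix 4 _≋_

    data _≋_ : Rel (Term X) (c ⊔ ℓ₁ ⊔ x ⊔ ρ) where
      relation    : ∀ {s t} → s ∼ t → s ≋ t
      ≋-refl      : ∀ {s} → s ≋ s
      ≋-sym       : ∀ {s t} → s ≋ t → t ≋ s
      ≋-trans     : ∀ {s t u} → s ≋ t → t ≋ u → s ≋ u
      ⊹-cong      : ∀ {s s′ t t′} → s ≋ s′ → t ≋ t′ → s ⊹ t ≋ s′ ⊹ t′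
      ⊹-assoc     : ∀ s t u → (s ⊹ t) ⊹ u ≋ s ⊹ (t ⊹ u)
      ⊹-comm      : ∀ s t → s ⊹ t ≋ t ⊹ s
      ⊹-identityˡ : ∀ s → 𝟘 ⊹ s ≋ s
      ·-cong      : ∀ {a b s t} → a K.≈ b → s ≋ t → a · s ≋ b · t
      ·-distribˡ  : ∀ a s t → a · (s ⊹ t) ≋ a · s ⊹ a · t
      ·-distribʳ  : ∀ s a b → (a K.+ b) · s ≋ a · s ⊹ b · s
      ·-assoc     : ∀ a b s → (a K.* b) · s ≋ a · (b · s)
      ·-identityˡ : ∀ s → K.1# · s ≋ s
      ·-zeroˡ     : ∀ s → K.0# · s ≋ 𝟘

    private
      ·-zeroʳ : ∀ a → a · 𝟘 ≋ 𝟘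
      ·-zeroʳ a = ≋-trans (·-cong K.refl (≋-sym (·-zeroˡ 𝟘)))
                    (≋-trans (≋-sym (·-assoc a K.0# 𝟘))
                      (≋-trans (·-cong (K.zeroʳ a) ≋-refl) (·-zeroˡ 𝟘)))

      neg-inverseˡ : ∀ s → (K.- K.1#) · s ⊹ s ≋ 𝟘
      neg-inverseˡ s = ≋-trans (⊹-cong ≋-refl (≋-sym (·-identityˡ s)))
                         (≋-trans (≋-sym (·-distribʳ s (K.- K.1#) K.1#))
                           (≋-trans (·-cong (K.-‿inverseˡ K.1#) ≋-refl) (·-zeroˡ s)))

    Presented : VectorSpace (c ⊔ x) (c ⊔ ℓ₁ ⊔ x ⊔ ρ)
    Presented = record
      { Carrierᴹ     = Term X
      ; _≈ᴹ_         = _≋_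
      ; _+ᴹ_         = _⊹_
      ; _*ₗ_         = _·_
      ; 0ᴹ           = 𝟘
      ; -ᴹ_          = (K.- K.1#) ·_
      ; isLeftModule = record
        { isLeftSemimodule = record
          { +ᴹ-isCommutativeMonoid = record
            { isMonoid = record
              { isSemigroup = record
                { isMagma = record
                  { isEquivalence = record { refl = ≋-refl ; sym = ≋-sym ; trans = ≋-trans }
                  ; ∙-cong        = ⊹-cong
                  }
                ; assoc = ⊹-assoc
                }
              ; identity = ⊹-identityˡ , λ s → ≋-trans (⊹-comm s 𝟘) (⊹-identityˡ s)
              }
            ; comm = ⊹-comm
            }
          ; isPreleftSemimodule = record
            { *ₗ-cong      = ·-cong
            ; *ₗ-zeroˡ     = ·-zeroˡ
            ; *ₗ-distribʳ  = ·-distribʳ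
            ; *ₗ-identityˡ = ·-identityˡ
            ; *ₗ-assoc     = ·-assoc
            ; *ₗ-zeroʳ     = ·-zeroʳ
            ; *ₗ-distribˡ  = ·-distribˡ
            }
          }
        ; -ᴹ‿cong    = ·-cong K.refl
        ; -ᴹ‿inverse = neg-inverseˡ , λ s → ≋-trans (⊹-comm s _) (neg-inverseˡ s)
        }
      }

  module _ {x a ℓa : Level} {X : Set x} (A : VectorSpace a ℓa) where
    private module A = LeftModule A

    eval : (X → A.Carrierᴹ) → Term X → A.Carrierᴹ
    eval f (gen x) = f x
    eval f 𝟘       = A.0ᴹ
    eval f (s ⊹ t) = eval f s A.+ᴹ eval f t
    eval f (r · s) = r A.*ₗ eval f s

    eval-ext : ∀ {f f′} → (∀ x → f x A.≈ᴹ f′ x) → ∀ t → eval f t A.≈ᴹ eval f′ t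
    eval-ext p (gen x) = p x
    eval-ext p 𝟘       = A.≈ᴹ-refl
    eval-ext p (s ⊹ t) = A.+ᴹ-cong (eval-ext p s) (eval-ext p t)
    eval-ext p (r · s) = A.*ₗ-congˡ (eval-ext p s)

    extend : ∀ {ρ} {_∼_ : Rel (Term X) ρ} (f : X → A.Carrierᴹ) → (∀ {s t} → s ∼ t → eval f s A.≈ᴹ eval f t) →
             LinearMap (Presented _∼_) A
    extend {_∼_ = _∼_} f f-∼ = linearMap (eval f) eval-cong (λ _ _ → A.≈ᴹ-refl) (λ _ _ → A.≈ᴹ-refl)
      where
      eval-cong : ∀ {s t} → _≋_ _∼_ s t → eval f s A.≈ᴹ eval f t
      eval-cong (relation p)       = f-∼ p
      eval-cong ≋-refl             = A.≈ᴹ-refl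
      eval-cong (≋-sym p)          = A.≈ᴹ-sym (eval-cong p)
      eval-cong (≋-trans p q)      = A.≈ᴹ-trans (eval-cong p) (eval-cong q)
      eval-cong (⊹-cong p q)       = A.+ᴹ-cong (eval-cong p) (eval-cong q)
      eval-cong (⊹-assoc s t u)    = A.+ᴹ-assoc _ _ _
      eval-cong (⊹-comm s t)       = A.+ᴹ-comm _ _
      eval-cong (⊹-identityˡ s)    = A.+ᴹ-identityˡ _
      eval-cong (·-cong p q)       = A.*ₗ-cong p (eval-cong q)
      eval-cong (·-distribˡ a s t) = A.*ₗ-distribˡ a _ _
      eval-cong (·-distribʳ s a b) = A.*ₗ-distribʳ _ a b
      eval-cong (·-assoc a b s)    = A.*ₗ-assoc a b _
      eval-cong (·-identityˡ s)    = A.*ₗ-identityˡ _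
      eval-cong (·-zeroˡ s)        = A.*ₗ-zeroˡ _

  module _ {v ℓv : Level} (V : VectorSpace v ℓv) where
    private module V = LeftModule V

    -- `gen w` stands for w₁ ∧ … ∧ wₘ.
    data WedgeRelation (m : ℕ) : Rel (Term (Vector V.Carrierᴹ m)) (c ⊔ v ⊔ ℓv) where
      pointwise   : ∀ {w w′} → (∀ i → w i V.≈ᴹ w′ i) → WedgeRelation m (gen w) (gen w′)
      additive    : ∀ w i x y → WedgeRelation m (gen (w [ i ]≔ x V.+ᴹ y))
                                                (gen (w [ i ]≔ x) ⊹ gen (w [ i ]≔ y))
      homogeneous : ∀ w i a x → WedgeRelation m (gen (w [ i ]≔ a V.*ₗ x))
                                                (a · gen (w [ i ]≔ x))
      alternating : ∀ w {i j} → i ≢ j → w i V.≈ᴹ w j → WedgeRelation m (gen w) 𝟘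

    -- For m = 0 there is, up to `pointwise`, a single generator (the empty
    -- wedge) and no further relation, so `⋀ 0` is a copy of the field.
    ⋀ : ℕ → VectorSpace (c ⊔ v) (c ⊔ ℓ₁ ⊔ v ⊔ ℓv)
    ⋀ m = Presented (WedgeRelation m)

  module InducedMaps {v ℓv : Level} {V : VectorSpace v ℓv} (T : LinearMap V V) (m : ℕ) where
    private
      module V = LeftModule V
      module T = LinearMap T
      module W = LeftModule (⋀ V m)

    Vᵐ : Set v
    Vᵐ = Vector V.Carrierᴹ m

    step : Fin m → Vᵐ → Vᵐ
    step p w = updateAt w p (T ⟨$⟩_)

    onWedge onWedge′ : Vᵐ → W.Carrierᴹ
    onWedge  w = gen (λ p → T ⟨$⟩ w p)
    onWedge′ w = sum W.+ᴹ-rawMonoid (λ p → gen (step p w))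

    wedge-cong : ∀ {w w′ : Vᵐ} → (∀ i → w i V.≈ᴹ w′ i) → gen w W.≈ᴹ gen w′
    wedge-cong p = relation (pointwise p)

    wedge-≗ : ∀ {w w′ : Vᵐ} → (∀ i → w i ≡ w′ i) → gen w W.≈ᴹ gen w′
    wedge-≗ p = wedge-cong (λ i → V.≈ᴹ-reflexive (p i))

    updateAt-≈ : ∀ {w w′ : Vᵐ} i {f f′} → (∀ j → j ≢ i → w j V.≈ᴹ w′ j) → f (w i) V.≈ᴹ f′ (w′ i) →
                 ∀ j → updateAt w i f j V.≈ᴹ updateAt w′ i f′ j
    updateAt-≈ {w} {w′} i p q j with j ≟ i
    ... | yes ≡.refl = V.≈ᴹ-trans (V.≈ᴹ-reflexive (updateAt-updates i w))
                         (V.≈ᴹ-trans q (V.≈ᴹ-reflexive (≡.sym (updateAt-updates i w′))))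
    ... | no j≢i     = V.≈ᴹ-trans (V.≈ᴹ-reflexive (updateAt-minimal j i w j≢i))
                         (V.≈ᴹ-trans (p j j≢i) (V.≈ᴹ-reflexive (≡.sym (updateAt-minimal j i w′ j≢i))))

    ≔-cong : ∀ (w : Vᵐ) i {x y} → x V.≈ᴹ y → gen (w [ i ]≔ x) W.≈ᴹ gen (w [ i ]≔ y)
    ≔-cong w i p = wedge-cong (updateAt-≈ i (λ _ _ → V.≈ᴹ-refl) p)

    onWedge-≔ : ∀ w i x → onWedge (w [ i ]≔ x) W.≈ᴹ gen ((λ p → T ⟨$⟩ w p) [ i ]≔ T ⟨$⟩ x)
    onWedge-≔ w i x = wedge-≗ (map-updateAt {f = T ⟨$⟩_} {g = const x} {h = const (T ⟨$⟩ x)} (λ _ → ≡.refl) w i)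

    step-≔-same : ∀ w i x → gen (step i (w [ i ]≔ x)) W.≈ᴹ gen (w [ i ]≔ T ⟨$⟩ x)
    step-≔-same w i x = wedge-≗ (updateAt-updateAt i w)

    step-≔-other : ∀ w {i p} x → p ≢ i → gen (step p (w [ i ]≔ x)) W.≈ᴹ gen (step p w [ i ]≔ x)
    step-≔-other w {i} {p} x p≢i = wedge-≗ (updateAt-commutes p i p≢i w)

    step-additive : ∀ w i x y p → gen (step p (w [ i ]≔ x V.+ᴹ y)) W.≈ᴹ
                                  gen (step p (w [ i ]≔ x)) W.+ᴹ gen (step p (w [ i ]≔ y))
    step-additive w i x y p with p ≟ i
    ... | yes ≡.refl = W.≈ᴹ-trans (step-≔-same w i _)
                         (W.≈ᴹ-trans (≔-cong w i (T.+ᴹ-homo x y))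
                           (W.≈ᴹ-trans (relation (additive w i _ _))
                             (W.≈ᴹ-sym (W.+ᴹ-cong (step-≔-same w i x) (step-≔-same w i y)))))
    ... | no p≢i     = W.≈ᴹ-trans (step-≔-other w _ p≢i)
                         (W.≈ᴹ-trans (relation (additive (step p w) i x y))
                           (W.≈ᴹ-sym (W.+ᴹ-cong (step-≔-other w x p≢i) (step-≔-other w y p≢i))))

    step-homogeneous : ∀ w i a x p → gen (step p (w [ i ]≔ a V.*ₗ x)) W.≈ᴹ a W.*ₗ gen (step p (w [ i ]≔ x))
    step-homogeneous w i a x p with p ≟ i
    ... | yes ≡.refl = W.≈ᴹ-trans (step-≔-same w i _)
                         (W.≈ᴹ-trans (≔-cong w i (T.*ₗ-homo a x))
                           (W.≈ᴹ-trans (relation (homogeneous w i a _))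
                             (W.≈ᴹ-sym (W.*ₗ-congˡ (step-≔-same w i x)))))
    ... | no p≢i     = W.≈ᴹ-trans (step-≔-other w _ p≢i)
                         (W.≈ᴹ-trans (relation (homogeneous (step p w) i a x))
                           (W.≈ᴹ-sym (W.*ₗ-congˡ (step-≔-other w x p≢i))))

    module _ (w : Vᵐ) {i j : Fin m} (i≢j : i ≢ j) where
      B : V.Carrierᴹ → V.Carrierᴹ → W.Carrierᴹ
      B x y = gen (w [ i ]≔ x [ j ]≔ y)

      B-swap : ∀ x y → B x y W.≈ᴹ gen (w [ j ]≔ y [ i ]≔ x)
      B-swap x y = wedge-≗ (updateAt-commutes j i (i≢j ∘ ≡.sym) w)

      B-additiveˡ : ∀ x x′ y → B (x V.+ᴹ x′) y W.≈ᴹ B x y W.+ᴹ B x′ y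
      B-additiveˡ x x′ y = W.≈ᴹ-trans (B-swap _ y)
                             (W.≈ᴹ-trans (relation (additive (w [ j ]≔ y) i x x′))
                               (W.≈ᴹ-sym (W.+ᴹ-cong (B-swap x y) (B-swap x′ y))))

      B-diagonal : ∀ x → B x x W.≈ᴹ W.0ᴹ
      B-diagonal x = relation (alternating _ i≢j (V.≈ᴹ-reflexive
        (≡.trans (updateAt-minimal i j (w [ i ]≔ x) i≢j)
          (≡.trans (updateAt-updates i w) (≡.sym (updateAt-updates j (w [ i ]≔ x)))))))

      B-antisymmetric : ∀ x y → B x y W.+ᴹ B y x W.≈ᴹ W.0ᴹ
      B-antisymmetric x y = W.≈ᴹ-sym (begin
        W.0ᴹ                                               ≈⟨ B-diagonal (x V.+ᴹ y) ⟨
        B (x V.+ᴹ y) (x V.+ᴹ y)                            ≈⟨ B-additiveˡ x y _ ⟩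
        B x (x V.+ᴹ y) W.+ᴹ B y (x V.+ᴹ y)                 ≈⟨ W.+ᴹ-cong (relation (additive _ j x y))
                                                                        (relation (additive _ j x y)) ⟩
        (B x x W.+ᴹ B x y) W.+ᴹ (B y x W.+ᴹ B y y)         ≈⟨ W.+ᴹ-cong (W.+ᴹ-congʳ (B-diagonal x))
                                                                        (W.+ᴹ-congˡ (B-diagonal y)) ⟩
        (W.0ᴹ W.+ᴹ B x y) W.+ᴹ (B y x W.+ᴹ W.0ᴹ)           ≈⟨ W.+ᴹ-cong (W.+ᴹ-identityˡ _) (W.+ᴹ-identityʳ _) ⟩
        B x y W.+ᴹ B y x                                   ∎)
        where open SetoidReasoning W.≈ᴹ-setoid

      step-pair : w i V.≈ᴹ w j → gen (step i w) W.+ᴹ gen (step j w) W.≈ᴹ W.0ᴹ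
      step-pair p = W.≈ᴹ-trans (W.+ᴹ-cong (wedge-cong eqᵢ) (wedge-cong eqⱼ)) (B-antisymmetric (T ⟨$⟩ w i) (w i))
        where
        eqᵢ : ∀ k → step i w k V.≈ᴹ (w [ i ]≔ T ⟨$⟩ w i [ j ]≔ w i) k
        eqᵢ k with k ≟ j
        ... | yes ≡.refl = V.≈ᴹ-trans (V.≈ᴹ-reflexive (updateAt-minimal k i w (i≢j ∘ ≡.sym)))
                             (V.≈ᴹ-trans (V.≈ᴹ-sym p) (V.≈ᴹ-reflexive (≡.sym (updateAt-updates k _))))
        ... | no k≢j     = V.≈ᴹ-trans (updateAt-≈ i (λ _ _ → V.≈ᴹ-refl) V.≈ᴹ-refl k)
                             (V.≈ᴹ-reflexive (≡.sym (updateAt-minimal k j _ k≢j)))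
        eqⱼ : ∀ k → step j w k V.≈ᴹ (w [ i ]≔ w i [ j ]≔ T ⟨$⟩ w i) k
        eqⱼ = updateAt-≈ j (λ k _ → unchanged k) (T.⟦⟧-cong (V.≈ᴹ-sym p))
          where
          unchanged : ∀ k → w k V.≈ᴹ (w [ i ]≔ w i) k
          unchanged k with k ≟ i
          ... | yes ≡.refl = V.≈ᴹ-reflexive (≡.sym (updateAt-updates k w))
          ... | no k≢i     = V.≈ᴹ-reflexive (≡.sym (updateAt-minimal k i w k≢i))

    open SumProperties W.+ᴹ-commutativeMonoid using (sum-cong-≋; ∑-distrib-+; sum-replicate-zero)

    Σ : ∀ {n} → Vector W.Carrierᴹ n → W.Carrierᴹ
    Σ = sum W.+ᴹ-rawMonoid

    Σ-zero : ∀ {n} (f : Vector W.Carrierᴹ n) → (∀ p → f p W.≈ᴹ W.0ᴹ) → Σ f W.≈ᴹ W.0ᴹ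
    Σ-zero {n} f f≈0 = W.≈ᴹ-trans (sum-cong-≋ f≈0) (sum-replicate-zero n)

    Σ-single : ∀ {n} (f : Vector W.Carrierᴹ n) i → (∀ p → p ≢ i → f p W.≈ᴹ W.0ᴹ) → Σ f W.≈ᴹ f i
    Σ-single f zero    f≈0 = W.≈ᴹ-trans (W.+ᴹ-congˡ (Σ-zero _ (λ p → f≈0 (suc p) (λ ())))) (W.+ᴹ-identityʳ _)
    Σ-single f (suc i) f≈0 = W.≈ᴹ-trans
      (W.+ᴹ-cong (f≈0 zero (λ ())) (Σ-single _ i (λ p p≢i → f≈0 (suc p) (p≢i ∘ suc-injective))))
      (W.+ᴹ-identityˡ _)

    Σ-pair : ∀ {n} (f : Vector W.Carrierᴹ n) i j → i ≢ j → (∀ p → p ≢ i → p ≢ j → f p W.≈ᴹ W.0ᴹ) →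
             Σ f W.≈ᴹ f i W.+ᴹ f j
    Σ-pair f zero    zero    i≢j f≈0 = contradiction ≡.refl i≢j
    Σ-pair f zero    (suc j) i≢j f≈0 =
      W.+ᴹ-congˡ (Σ-single _ j (λ p p≢j → f≈0 (suc p) (λ ()) (p≢j ∘ suc-injective)))
    Σ-pair f (suc i) zero    i≢j f≈0 = W.≈ᴹ-trans
      (W.+ᴹ-congˡ (Σ-single _ i (λ p p≢i → f≈0 (suc p) (p≢i ∘ suc-injective) (λ ()))))
      (W.+ᴹ-comm _ _)
    Σ-pair f (suc i) (suc j) i≢j f≈0 = W.≈ᴹ-trans
      (W.+ᴹ-cong (f≈0 zero (λ ()) (λ ()))
        (Σ-pair _ i j (i≢j ∘ ≡.cong suc)
          (λ p p≢i p≢j → f≈0 (suc p) (p≢i ∘ suc-injective) (p≢j ∘ suc-injective))))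
      (W.+ᴹ-identityˡ _)

    Σ-· : ∀ {n} a (f : Vector W.Carrierᴹ n) → Σ (λ p → a W.*ₗ f p) W.≈ᴹ a W.*ₗ Σ f
    Σ-· {ℕ.zero}  a f = W.≈ᴹ-sym (W.*ₗ-zeroʳ a)
    Σ-· {ℕ.suc n} a f = W.≈ᴹ-trans (W.+ᴹ-congˡ (Σ-· {n} a _)) (W.≈ᴹ-sym (W.*ₗ-distribˡ a _ _))

    onWedge-∼ : ∀ {s t} → WedgeRelation V m s t → eval (⋀ V m) onWedge s W.≈ᴹ eval (⋀ V m) onWedge t
    onWedge-∼ (pointwise p)         = wedge-cong (λ i → T.⟦⟧-cong (p i))
    onWedge-∼ (additive w i x y)    = W.≈ᴹ-trans (onWedge-≔ w i _)
      (W.≈ᴹ-trans (≔-cong _ i (T.+ᴹ-homo x y))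
        (W.≈ᴹ-trans (relation (additive _ i _ _))
          (W.≈ᴹ-sym (W.+ᴹ-cong (onWedge-≔ w i x) (onWedge-≔ w i y)))))
    onWedge-∼ (homogeneous w i a x) = W.≈ᴹ-trans (onWedge-≔ w i _)
      (W.≈ᴹ-trans (≔-cong _ i (T.*ₗ-homo a x))
        (W.≈ᴹ-trans (relation (homogeneous _ i a _)) (W.≈ᴹ-sym (W.*ₗ-congˡ (onWedge-≔ w i x)))))
    onWedge-∼ (alternating w i≢j p) = relation (alternating _ i≢j (T.⟦⟧-cong p))

    onWedge′-∼ : ∀ {s t} → WedgeRelation V m s t → eval (⋀ V m) onWedge′ s W.≈ᴹ eval (⋀ V m) onWedge′ t
    onWedge′-∼ (pointwise q)         =
      sum-cong-≋ (λ p → wedge-cong (updateAt-≈ p {T ⟨$⟩_} {T ⟨$⟩_} (λ j _ → q j) (T.⟦⟧-cong (q p))))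
    onWedge′-∼ (additive w i x y)    =
      W.≈ᴹ-trans (sum-cong-≋ (step-additive w i x y)) (∑-distrib-+ {m} _ _)
    onWedge′-∼ (homogeneous w i a x) =
      W.≈ᴹ-trans (sum-cong-≋ (step-homogeneous w i a x)) (Σ-· {m} a _)
    onWedge′-∼ (alternating w {i} {j} i≢j q) =
      W.≈ᴹ-trans (Σ-pair _ i j i≢j vanish) (step-pair w i≢j q)
      where
      vanish : ∀ p → p ≢ i → p ≢ j → gen (step p w) W.≈ᴹ W.0ᴹ
      vanish p p≢i p≢j = relation (alternating _ i≢j
        (V.≈ᴹ-trans (V.≈ᴹ-reflexive (updateAt-minimal i p w (p≢i ∘ ≡.sym)))
          (V.≈ᴹ-trans q (V.≈ᴹ-reflexive (≡.sym (updateAt-minimal j p w (p≢j ∘ ≡.sym)))))))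

    -- w₁ ∧ … ∧ wₘ  ↦  T w₁ ∧ … ∧ T wₘ
    diagonalMap : LinearMap (⋀ V m) (⋀ V m)
    diagonalMap = extend (⋀ V m) onWedge onWedge-∼

    -- w₁ ∧ … ∧ wₘ  ↦  ∑ₚ w₁ ∧ … ∧ T wₚ ∧ … ∧ wₘ
    derivationMap : LinearMap (⋀ V m) (⋀ V m)
    derivationMap = extend (⋀ V m) onWedge′ onWedge′-∼

  open InducedMaps public using (diagonalMap; derivationMap)

  module _ {v ℓv : Level} {V : VectorSpace v ℓv} {S T : LinearMap V V} (m : ℕ) (S≈T : _≈ᴱ_ V S T) where
    private
      module V = LeftModule V
      module W = LeftModule (⋀ V m)
      open SumProperties W.+ᴹ-commutativeMonoid using (sum-cong-≋)

    diagonalMap-cong : _≈ᴱ_ (⋀ V m) (diagonalMap S m) (diagonalMap T m)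
    diagonalMap-cong = eval-ext (⋀ V m) (λ w → relation (pointwise (λ p → S≈T (w p))))

    derivationMap-cong : _≈ᴱ_ (⋀ V m) (derivationMap S m) (derivationMap T m)
    derivationMap-cong = eval-ext (⋀ V m) (λ w → sum-cong-≋ (λ p →
      InducedMaps.wedge-cong T m
        (InducedMaps.updateAt-≈ T m p {S ⟨$⟩_} {T ⟨$⟩_} (λ _ _ → V.≈ᴹ-refl) (S≈T (w p)))))

  record AssociativeAlgebra (a ℓa : Level) : Set (c ⊔ ℓ₁ ⊔ lsuc (a ⊔ ℓa)) where
    field
      vectorSpace : VectorSpace a ℓa
    open LeftModule vectorSpace public
    infixl 7 _∙_
    field
      _∙_         : Op₂ Carrierᴹ
      1ᴬ          : Carrierᴹ
      isRing      : IsRing _≈ᴹ_ _+ᴹ_ _∙_ -ᴹ_ 0ᴹ 1ᴬ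
      *ₗ-∙-assoc  : ∀ r x y → (r *ₗ x) ∙ y ≈ᴹ r *ₗ (x ∙ y)
      ∙-*ₗ-comm   : ∀ r x y → x ∙ (r *ₗ y) ≈ᴹ r *ₗ (x ∙ y)

    ring : Ring a ℓa
    ring = record { isRing = isRing }

  record LieAlgebra (a ℓa : Level) : Set (c ⊔ ℓ₁ ⊔ lsuc (a ⊔ ℓa)) where
    field
      vectorSpace : VectorSpace a ℓa
    open LeftModule vectorSpace public
    field
      [_,_]       : Op₂ Carrierᴹ
      []-cong     : ∀ {x x′ y y′} → x ≈ᴹ x′ → y ≈ᴹ y′ → [ x , y ] ≈ᴹ [ x′ , y′ ]
      []-+ˡ       : ∀ x y z → [ x +ᴹ y , z ] ≈ᴹ [ x , z ] +ᴹ [ y , z ]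
      []-+ʳ       : ∀ x y z → [ x , y +ᴹ z ] ≈ᴹ [ x , y ] +ᴹ [ x , z ]
      []-*ˡ       : ∀ r x y → [ r *ₗ x , y ] ≈ᴹ r *ₗ [ x , y ]
      []-*ʳ       : ∀ r x y → [ x , r *ₗ y ] ≈ᴹ r *ₗ [ x , y ]
      []-self     : ∀ x → [ x , x ] ≈ᴹ 0ᴹ
      jacobi      : ∀ x y z → [ x , [ y , z ] ] +ᴹ [ y , [ z , x ] ] +ᴹ [ z , [ x , y ] ] ≈ᴹ 0ᴹ

  record IsLieSubalgebra {a ℓa p : Level} (L : LieAlgebra a ℓa) (P : Pred (LieAlgebra.Carrierᴹ L) p)
                         : Set (c ⊔ a ⊔ ℓa ⊔ p) where
    open LieAlgebra L
    field
      respects  : P Respects _≈ᴹ_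
      0-closed  : P 0ᴹ
      +-closed  : ∀ {x y} → P x → P y → P (x +ᴹ y)
      *-closed  : ∀ r {x} → P x → P (r *ₗ x)
      []-closed : ∀ {x y} → P x → P y → P [ x , y ]

  module _ {a ℓa : Level} (A : AssociativeAlgebra a ℓa) where
    private
      open AssociativeAlgebra A
      open IsRing isRing using (distribˡ; distribʳ; *-assoc; *-cong; +-cong; +-congˡ; +-congʳ; -‿cong; -‿inverseʳ)
      open RingProperties ring using (x[y-z]≈xy-xz; [y-z]x≈yx-zx)
      open AbelianGroupProperties +ᴹ-abelianGroup using (⁻¹-∙-comm; ⁻¹-anti-homo‿-)
      open CommutativeMonoidSolver +ᴹ-commutativeMonoid using (solve; _⊕_; _⊜_)
      open SetoidReasoning ≈ᴹ-setoid

      infixl 6 _-_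
      _-_ : Op₂ Carrierᴹ
      x - y = x +ᴹ -ᴹ y

      minus-cong : ∀ {x x′ y y′} → x ≈ᴹ x′ → y ≈ᴹ y′ → x - y ≈ᴹ x′ - y′
      minus-cong p q = +-cong p (-‿cong q)

      +-minus-+ : ∀ w x y z → (w +ᴹ x) - (y +ᴹ z) ≈ᴹ (w - y) +ᴹ (x - z)
      +-minus-+ w x y z = ≈ᴹ-trans (+-congˡ (≈ᴹ-sym (⁻¹-∙-comm y z)))
        (solve 4 (λ p q s t → (p ⊕ q) ⊕ (s ⊕ t) ⊜ (p ⊕ s) ⊕ (q ⊕ t)) ≈ᴹ-refl w x (-ᴹ y) (-ᴹ z))

      *ₗ-minus : ∀ r x y → (r *ₗ x) - (r *ₗ y) ≈ᴹ r *ₗ (x - y)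
      *ₗ-minus r x y = ≈ᴹ-trans (+-congˡ (≈ᴹ-sym (LeftModuleProperties.inverseˡ-uniqueᴹ vectorSpace _ _
        (≈ᴹ-trans (≈ᴹ-sym (*ₗ-distribˡ r _ _)) (≈ᴹ-trans (*ₗ-congˡ (-ᴹ‿inverseˡ y)) (*ₗ-zeroʳ r))))))
        (≈ᴹ-sym (*ₗ-distribˡ r _ _))

      bracket : Op₂ Carrierᴹ
      bracket x y = x ∙ y - y ∙ x

      minus-minus : ∀ p q s t → (p - q) - (s - t) ≈ᴹ (p +ᴹ t) - (q +ᴹ s)
      minus-minus p q s t = begin
        (p - q) - (s - t)              ≈⟨ +-congˡ (⁻¹-anti-homo‿- s t) ⟩
        (p - q) +ᴹ (t - s)             ≈⟨ +-minus-+ p t q s ⟨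
        (p +ᴹ t) - (q +ᴹ s)            ∎

      bracket-bracket : ∀ x y z → bracket x (bracket y z) ≈ᴹ
                        (x ∙ y ∙ z +ᴹ z ∙ y ∙ x) - (y ∙ z ∙ x +ᴹ x ∙ z ∙ y)
      bracket-bracket x y z = begin
        x ∙ (y ∙ z - z ∙ y) - (y ∙ z - z ∙ y) ∙ x
          ≈⟨ minus-cong (x[y-z]≈xy-xz x _ _) ([y-z]x≈yx-zx x _ _) ⟩
        (x ∙ (y ∙ z) - x ∙ (z ∙ y)) - (y ∙ z ∙ x - z ∙ y ∙ x)
          ≈⟨ minus-minus _ _ _ _ ⟩
        (x ∙ (y ∙ z) +ᴹ z ∙ y ∙ x) - (x ∙ (z ∙ y) +ᴹ y ∙ z ∙ x)
          ≈⟨ minus-cong (+-congʳ (≈ᴹ-sym (*-assoc x y z)))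
                    (≈ᴹ-trans (+-congʳ (≈ᴹ-sym (*-assoc x z y))) (+ᴹ-comm _ _)) ⟩
        (x ∙ y ∙ z +ᴹ z ∙ y ∙ x) - (y ∙ z ∙ x +ᴹ x ∙ z ∙ y)
          ∎

      telescope : ∀ p q s → (p - q) +ᴹ (q - s) +ᴹ (s - p) ≈ᴹ 0ᴹ
      telescope p q s = begin
        (p - q) +ᴹ (q - s) +ᴹ (s - p)
          ≈⟨ solve 6 (λ p p′ q q′ s s′ → ((p ⊕ q′) ⊕ (q ⊕ s′)) ⊕ (s ⊕ p′) ⊜ ((p ⊕ p′) ⊕ (q ⊕ q′)) ⊕ (s ⊕ s′))
               ≈ᴹ-refl p (-ᴹ p) q (-ᴹ q) s (-ᴹ s) ⟩
        (p - p) +ᴹ (q - q) +ᴹ (s - s)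
          ≈⟨ +-cong (+-cong (-‿inverseʳ p) (-‿inverseʳ q)) (-‿inverseʳ s) ⟩
        0ᴹ +ᴹ 0ᴹ +ᴹ 0ᴹ
          ≈⟨ ≈ᴹ-trans (+ᴹ-identityʳ _) (+ᴹ-identityʳ _) ⟩
        0ᴹ
          ∎

    commutatorLieAlgebra : LieAlgebra a ℓa
    commutatorLieAlgebra = record
      { vectorSpace = vectorSpace
      ; [_,_]       = λ x y → x ∙ y - y ∙ x
      ; []-cong     = λ p q → minus-cong (*-cong p q) (*-cong q p)
      ; []-+ˡ       = λ x y z → ≈ᴹ-trans (minus-cong (distribʳ z x y) (distribˡ z x y)) (+-minus-+ _ _ _ _)
      ; []-+ʳ       = λ x y z → ≈ᴹ-trans (minus-cong (distribˡ x y z) (distribʳ x y z)) (+-minus-+ _ _ _ _)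
      ; []-*ˡ       = λ r x y → ≈ᴹ-trans (minus-cong (*ₗ-∙-assoc r x y) (∙-*ₗ-comm r y x)) (*ₗ-minus r _ _)
      ; []-*ʳ       = λ r x y → ≈ᴹ-trans (minus-cong (∙-*ₗ-comm r x y) (*ₗ-∙-assoc r y x)) (*ₗ-minus r _ _)
      ; []-self     = λ x → -‿inverseʳ (x ∙ x)
      ; jacobi      = λ x y z → ≈ᴹ-trans
          (+-cong (+-cong (bracket-bracket x y z) (bracket-bracket y z x)) (bracket-bracket z x y))
          (telescope (x ∙ y ∙ z +ᴹ z ∙ y ∙ x) (y ∙ z ∙ x +ᴹ x ∙ z ∙ y) (z ∙ x ∙ y +ᴹ y ∙ x ∙ z))
      }

  module _ {g ℓg : Level} (G : Group g ℓg) where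
    private module G = Group G

    -- K[G] is free on the setoid G: the only relations identify equal elements of G.
    data GroupRelation : Rel (Term G.Carrier) (c ⊔ g ⊔ ℓg) where
      same : ∀ {x y} → x G.≈ y → GroupRelation (gen x) (gen y)

    private
      KG : VectorSpace (c ⊔ g) (c ⊔ ℓ₁ ⊔ g ⊔ ℓg)
      KG = Presented GroupRelation

    -- The bilinear extension of gen x ⊛ gen y = gen (x ∙ y).
    infixl 7 _⊛_

    _⊛_ : Op₂ (Term G.Carrier)
    s ⊛ t = eval KG (λ x → eval KG (λ y → gen (x G.∙ y)) t) s

    private
      module KG = LeftModule KG
      open CommutativeMonoidSolver KG.+ᴹ-commutativeMonoid using (solve; _⊕_; _⊜_)

      _≈_ : Rel (Term G.Carrier) (c ⊔ ℓ₁ ⊔ g ⊔ ℓg)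
      _≈_ = _≋_ GroupRelation

      ⊛-congʳ : ∀ s {t t′} → t ≈ t′ → (s ⊛ t) ≈ (s ⊛ t′)
      ⊛-congʳ s p = eval-ext KG (λ x → LinearMap.⟦⟧-cong (translation x) p) s
        where
        translation : G.Carrier → LinearMap KG KG
        translation x = extend KG (λ y → gen (x G.∙ y)) (λ { (same p) → relation (same (G.∙-congˡ p)) })

      ⊛-congˡ : ∀ {s s′} t → s ≈ s′ → (s ⊛ t) ≈ (s′ ⊛ t)
      ⊛-congˡ t = LinearMap.⟦⟧-cong {A = KG} {B = KG} (extend KG _
        (λ { (same p) → eval-ext KG (λ y → relation (same (G.∙-congʳ p))) t }))

      distribˡ : ∀ s t u → (s ⊛ (t ⊹ u)) ≈ (s ⊛ t ⊹ s ⊛ u)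
      distribˡ (gen x)  t u = ≋-refl
      distribˡ 𝟘        t u = ≋-sym (⊹-identityˡ 𝟘)
      distribˡ (s ⊹ s′) t u = ≋-trans (⊹-cong (distribˡ s t u) (distribˡ s′ t u))
        (solve 4 (λ p q r s → (p ⊕ q) ⊕ (r ⊕ s) ⊜ (p ⊕ r) ⊕ (q ⊕ s)) ≋-refl _ _ _ _)
      distribˡ (r · s)  t u = ≋-trans (·-cong K.refl (distribˡ s t u)) (·-distribˡ r _ _)

      ⊛-· : ∀ r s t → (s ⊛ (r · t)) ≈ (r · (s ⊛ t))
      ⊛-· r (gen x)  t = ≋-refl
      ⊛-· r 𝟘        t = ≋-sym (KG.*ₗ-zeroʳ r)
      ⊛-· r (s ⊹ s′) t = ≋-trans (⊹-cong (⊛-· r s t) (⊛-· r s′ t)) (≋-sym (·-distribˡ r _ _))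
      ⊛-· r (a · s)  t = ≋-trans (·-cong K.refl (⊛-· r s t))
        (≋-trans (≋-sym (·-assoc a r _)) (≋-trans (·-cong (K.*-comm a r) ≋-refl) (·-assoc r a _)))

      assoc : ∀ s t u → ((s ⊛ t) ⊛ u) ≈ (s ⊛ (t ⊛ u))
      assoc (gen x)  (gen y) (gen z) = relation (same (G.assoc x y z))
      assoc (gen x)  (gen y) 𝟘       = ≋-refl
      assoc (gen x)  (gen y) (u ⊹ v) = ⊹-cong (assoc (gen x) (gen y) u) (assoc (gen x) (gen y) v)
      assoc (gen x)  (gen y) (r · u) = ·-cong K.refl (assoc (gen x) (gen y) u)
      assoc (gen x)  𝟘       u       = ≋-refl
      assoc (gen x)  (s ⊹ t) u       = ⊹-cong (assoc (gen x) s u) (assoc (gen x) t u)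
      assoc (gen x)  (r · t) u       = ·-cong K.refl (assoc (gen x) t u)
      assoc 𝟘        t       u       = ≋-refl
      assoc (s ⊹ s′) t       u       = ⊹-cong (assoc s t u) (assoc s′ t u)
      assoc (r · s)  t       u       = ·-cong K.refl (assoc s t u)

      identityˡ : ∀ t → (gen G.ε ⊛ t) ≈ t
      identityˡ (gen x) = relation (same (G.identityˡ x))
      identityˡ 𝟘       = ≋-refl
      identityˡ (s ⊹ t) = ⊹-cong (identityˡ s) (identityˡ t)
      identityˡ (r · t) = ·-cong K.refl (identityˡ t)

      identityʳ : ∀ t → (t ⊛ gen G.ε) ≈ t
      identityʳ (gen x) = relation (same (G.identityʳ x))
      identityʳ 𝟘       = ≋-refl
      identityʳ (s ⊹ t) = ⊹-cong (identityʳ s) (identityʳ t)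
      identityʳ (r · t) = ·-cong K.refl (identityʳ t)

    groupAlgebra : AssociativeAlgebra (c ⊔ g) (c ⊔ ℓ₁ ⊔ g ⊔ ℓg)
    groupAlgebra = record
      { vectorSpace = KG
      ; _∙_         = _⊛_
      ; 1ᴬ          = gen G.ε
      ; isRing      = record
        { +-isAbelianGroup = KG.+ᴹ-isAbelianGroup
        ; *-cong           = λ {_} {s′} {t} p q → ≋-trans (⊛-congˡ t p) (⊛-congʳ s′ q)
        ; *-assoc          = assoc
        ; *-identity       = identityˡ , identityʳ
        ; distrib          = distribˡ , λ _ _ _ → ≋-refl
        }
      ; *ₗ-∙-assoc  = λ _ _ _ → ≋-refl
      ; ∙-*ₗ-comm   = ⊛-·
      }

    groupLieAlgebra : LieAlgebra (c ⊔ g) (c ⊔ ℓ₁ ⊔ g ⊔ ℓg)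
    groupLieAlgebra = commutatorLieAlgebra groupAlgebra

  module _ {g ℓg v ℓv : Level} (G : Group g ℓg) (V : VectorSpace v ℓv) where
    private module G = Group G
    open MonoidMorphisms G.rawMonoid (End-rawMonoid V) using (IsMonoidHomomorphism)

    -- A monoid homomorphism out of a group lands in the invertible elements,
    -- so this is a group homomorphism G → GL(V).
    record Representation : Set (c ⊔ g ⊔ ℓg ⊔ v ⊔ ℓv) where
      field
        ρ                    : G.Carrier → LinearMap V V
        isMonoidHomomorphism : IsMonoidHomomorphism ρ
      open IsMonoidHomomorphism isMonoidHomomorphism public

  module _ {g ℓg v ℓv : Level} {G : Group g ℓg} {V : VectorSpace v ℓv} (R : Representation G V) where
    private
      open Representation R
      K[G] : VectorSpace (c ⊔ g) (c ⊔ ℓ₁ ⊔ g ⊔ ℓg)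
      K[G] = AssociativeAlgebra.vectorSpace (groupAlgebra G)

    𝒢 𝒜 : ∀ m → LinearMap K[G] (End (⋀ V m))
    𝒢 m = extend (End (⋀ V m)) (λ x → diagonalMap (ρ x) m)
                 (λ { (same {x} {y} p) → diagonalMap-cong {S = ρ x} {T = ρ y} m (⟦⟧-cong p) })
    𝒜 m = extend (End (⋀ V m)) (λ x → derivationMap (ρ x) m)
                 (λ { (same {x} {y} p) → derivationMap-cong {S = ρ x} {T = ρ y} m (⟦⟧-cong p) })

    IsLieElement : FiniteDimensional V → Pred (LeftModule.Carrierᴹ K[G]) (c ⊔ ℓ₁ ⊔ v ⊔ ℓv)
    IsLieElement finite x = ∀ m → m ≤ FiniteDimensional.dim finite → _≈ᴱ_ (⋀ V m) (𝒢 m ⟨$⟩ x) (𝒜 m ⟨$⟩ x)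

-- Both 𝒢ₘ and 𝒜ₘ are homomorphisms of Lie algebras k[G] → End(⋀ᵐ V): 𝒢ₘ because it is already
-- multiplicative, 𝒜ₘ because in 𝒜ₘ⟨g⟩ 𝒜ₘ⟨h⟩ the terms where g and h act on different factors are
-- symmetric in g and h, while those where they act on the same factor add up to 𝒜ₘ⟨gh⟩. The Lie
-- elements are the common equalizer of these pairs of homomorphisms, hence a Lie subalgebra.

module Submission where

open import Defs
open import Algebra.Apartness.Bundles using (HeytingField)
open import Algebra.Bundles using (Group; CommutativeMonoid; AbelianGroup; RawMonoid)
open import Algebra.Module.Bundles using (LeftModule)
import Algebra.Properties.CommutativeMonoid.Sum as SumProperties
import Algebra.Solver.CommutativeMonoid as CommutativeMonoidSolver
open import Data.Fin.Base using (Fin; suc)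
open import Data.Fin.Properties using (punchInᵢ≢i)
open import Data.Nat.Base using (ℕ)
open import Data.Product.Base using (_,_)
open import Data.Vec.Functional using (Vector; removeAt)
open import Data.Vec.Functional.Properties using (updateAt-updateAt; updateAt-commutes)
open import Function.Base using (_∘_)
open import Level using (Level)
open import Relation.Binary.Core using (Rel)
open import Relation.Binary.PropositionalEquality using (_≢_)
import Relation.Binary.Reasoning.Setoid as SetoidReasoning

-- Rearranging sums in commutative monoids and abelian groups.

module _ {c ℓ} (M : CommutativeMonoid c ℓ) where
  open CommutativeMonoid M renaming (_∙_ to _+_; ∙-congˡ to +-congˡ; ∙-congʳ to +-congʳ)
  open SumProperties M
  open CommutativeMonoidSolver M using (solve; _⊕_; _⊜_)
  open SetoidReasoning setoid

  -- The sums differ only in their entries at `i`; giving each side the other's entry expresses this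
  -- without subtraction.
  sum-swap-entry : ∀ {n} {f h : Vector Carrier n} i → (∀ j → j ≢ i → f j ≈ h j) →
                   sum f + h i ≈ sum h + f i
  sum-swap-entry {ℕ.suc n} {f} {h} i f≈h = begin
    sum f + h i                          ≈⟨ +-congʳ (sum-remove f) ⟩
    (f i + sum (removeAt f i)) + h i     ≈⟨ +-congʳ (+-congˡ (sum-cong-≋ (λ j → f≈h _ (punchInᵢ≢i i j)))) ⟩
    (f i + sum (removeAt h i)) + h i     ≈⟨ solve 3 (λ x y z → (x ⊕ y) ⊕ z ⊜ (z ⊕ y) ⊕ x) refl _ _ _ ⟩
    (h i + sum (removeAt h i)) + f i     ≈⟨ +-congʳ (sum-remove h) ⟨
    sum h + f i                          ∎

  -- Row `i` of `f` is column `i` of `h` except on the diagonal, so `sum-swap-entry` applies row by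
  -- row, and exchanging the order of summation turns columns of `h` into rows.
  ∑∑-swap-diagonal : ∀ {n} (f h : Fin n → Fin n → Carrier) → (∀ i j → j ≢ i → f i j ≈ h j i) →
                     sum (λ i → sum (f i)) + sum (λ i → h i i) ≈ sum (λ i → sum (h i)) + sum (λ i → f i i)
  ∑∑-swap-diagonal {n} f h f≈h = begin
    sum (λ i → sum (f i)) + sum (λ i → h i i)
      ≈⟨ ∑-distrib-+ {n} _ _ ⟨
    sum (λ i → sum (f i) + h i i)
      ≈⟨ sum-cong-≋ (λ i → sum-swap-entry i (f≈h i)) ⟩
    sum (λ i → sum (λ j → h j i) + f i i)
      ≈⟨ ∑-distrib-+ {n} _ _ ⟩
    sum (λ i → sum (λ j → h j i)) + sum (λ i → f i i)
      ≈⟨ +-congʳ (∑-comm {n} {n} (λ i j → h j i)) ⟩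
    sum (λ i → sum (h i)) + sum (λ i → f i i)
      ∎

module _ {c ℓ} (A : AbelianGroup c ℓ) where
  open AbelianGroup A renaming (_∙_ to _+_)
  open CommutativeMonoidSolver commutativeMonoid using (solve; _⊕_; _⊜_)
  open SetoidReasoning setoid

  -- Turns the subtraction-free identity `derivationMap-∘` back into an equality of commutators.
  +-equation⇒minus-equation : ∀ {w x y z} → x + w ≈ y + z → z - w ≈ x - y
  +-equation⇒minus-equation {w} {x} {y} {z} p = begin
    z - w
      ≈⟨ identityʳ _ ⟨
    (z - w) + ε
      -- Inserting `y - y` makes `y + z` appear, so that `p` applies.
      ≈⟨ ∙-congˡ (inverseʳ y) ⟨
    (z - w) + (y - y)
      ≈⟨ solve 4 (λ z w′ y y′ → (z ⊕ w′) ⊕ (y ⊕ y′) ⊜ (y ⊕ z) ⊕ (w′ ⊕ y′)) refl z (w ⁻¹) y (y ⁻¹) ⟩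
    (y + z) + (w ⁻¹ + y ⁻¹)
      ≈⟨ ∙-congʳ p ⟨
    (x + w) + (w ⁻¹ + y ⁻¹)
      ≈⟨ solve 4 (λ x w w′ y′ → (x ⊕ w) ⊕ (w′ ⊕ y′) ⊜ (x ⊕ y′) ⊕ (w ⊕ w′)) refl x w (w ⁻¹) (y ⁻¹) ⟩
    (x - y) + (w - w)
      ≈⟨ ∙-congˡ (inverseʳ w) ⟩
    (x - y) + ε
      ≈⟨ identityʳ _ ⟩
    x - y
      ∎

module _ {c ℓ₁ ℓ₂ : Level} (K : HeytingField c ℓ₁ ℓ₂) where

  open LinearMap using (_⟨$⟩_)

  -- Linear maps: finite sums, equalizers, agreement on generators.

  module _ {a ℓa b ℓb : Level} {A : VectorSpace K a ℓa} {B : VectorSpace K b ℓb} (f : LinearMap K A B) where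
    private
      module A = LeftModule A
      module B = LeftModule B
      module f = LinearMap f

    sum-homo : ∀ {n} (v : Vector A.Carrierᴹ n) →
               f ⟨$⟩ (SumProperties.sum A.+ᴹ-commutativeMonoid v)
               B.≈ᴹ SumProperties.sum B.+ᴹ-commutativeMonoid (λ i → f ⟨$⟩ v i)
    sum-homo {ℕ.zero}  v = f.0ᴹ-homo
    sum-homo {ℕ.suc n} v = B.≈ᴹ-trans (f.+ᴹ-homo _ _) (B.+ᴹ-congˡ (sum-homo (v ∘ suc)))

  module _ {a ℓa b ℓb : Level} {A : VectorSpace K a ℓa} {B : VectorSpace K b ℓb} (f g : LinearMap K A B) where
    private
      module A = LeftModule A
      module B = LeftModule B
      module f = LinearMap f
      module g = LinearMap g

      -- For `𝒢` and `𝒜` in degree `m` this is the degree `m` part of being a Lie element.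
      Equal : A.Carrierᴹ → Set ℓb
      Equal x = f ⟨$⟩ x B.≈ᴹ g ⟨$⟩ x

    equalizer-respects : ∀ {x y} → x A.≈ᴹ y → Equal x → Equal y
    equalizer-respects p q = B.≈ᴹ-trans (f.⟦⟧-cong (A.≈ᴹ-sym p)) (B.≈ᴹ-trans q (g.⟦⟧-cong p))

    equalizer-0 : Equal A.0ᴹ
    equalizer-0 = B.≈ᴹ-trans f.0ᴹ-homo (B.≈ᴹ-sym g.0ᴹ-homo)

    equalizer-+ : ∀ x y → Equal x → Equal y → Equal (x A.+ᴹ y)
    equalizer-+ x y p q = B.≈ᴹ-trans (f.+ᴹ-homo x y) (B.≈ᴹ-trans (B.+ᴹ-cong p q) (B.≈ᴹ-sym (g.+ᴹ-homo x y)))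

    equalizer-* : ∀ r x → Equal x → Equal (r A.*ₗ x)
    equalizer-* r x p = B.≈ᴹ-trans (f.*ₗ-homo r x) (B.≈ᴹ-trans (B.*ₗ-congˡ p) (B.≈ᴹ-sym (g.*ₗ-homo r x)))

  module _ {x ρ b ℓb : Level} {X : Set x} {_∼_ : Rel (Term K X) ρ} {B : VectorSpace K b ℓb}
           (f g : LinearMap K (Presented K _∼_) B) where
    private module B = LeftModule B

    -- The terms on which `f` and `g` agree form a subspace, and every term is a linear expression
    -- in generators.
    linear-ext : (∀ x → f ⟨$⟩ gen x B.≈ᴹ g ⟨$⟩ gen x) → ∀ t → f ⟨$⟩ t B.≈ᴹ g ⟨$⟩ t
    linear-ext p (gen x) = p x
    linear-ext p 𝟘       = equalizer-0 f g
    linear-ext p (s ⊹ t) = equalizer-+ f g s t (linear-ext p s) (linear-ext p t)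
    linear-ext p (r · s) = equalizer-* f g r s (linear-ext p s)

  -- The Lie algebra of endomorphisms, and bracket-preserving maps out of the group algebra.

  module _ {a ℓa : Level} (A : VectorSpace K a ℓa) where
    private
      module A = LeftModule A
      module E = LeftModule (End K A)
      module ∘ = RawMonoid (End-rawMonoid K A)

    endomorphismAlgebra : AssociativeAlgebra K _ _
    endomorphismAlgebra = record
      { vectorSpace = End K A
      ; _∙_         = ∘._∙_
      ; 1ᴬ          = ∘.ε
      ; isRing      = record
        { +-isAbelianGroup = E.+ᴹ-isAbelianGroup
        ; *-cong           = λ {S} {S′} {T} {T′} p q x →
                               A.≈ᴹ-trans (p (T ⟨$⟩ x)) (LinearMap.⟦⟧-cong S′ (q x))
        ; *-assoc          = λ _ _ _ _ → A.≈ᴹ-refl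
        ; *-identity       = (λ _ _ → A.≈ᴹ-refl) , (λ _ _ → A.≈ᴹ-refl)
        -- Sums of maps are pointwise, so distributivity holds by definition on one side and is the
        -- additivity of `S` on the other.
        ; distrib          = (λ S T U x → LinearMap.+ᴹ-homo S _ _) , (λ _ _ _ _ → A.≈ᴹ-refl)
        }
      ; *ₗ-∙-assoc  = λ _ _ _ _ → A.≈ᴹ-refl
      ; ∙-*ₗ-comm   = λ r S T x → LinearMap.*ₗ-homo S r _
      }

    endomorphismLieAlgebra : LieAlgebra K _ _
    endomorphismLieAlgebra = commutatorLieAlgebra K endomorphismAlgebra

  module _ {a ℓa : Level} (L : LieAlgebra K a ℓa) where
    open LieAlgebra L

    []-zeroˡ : ∀ x → [ 0ᴹ , x ] ≈ᴹ 0ᴹ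
    []-zeroˡ x = ≈ᴹ-trans ([]-cong (≈ᴹ-sym (*ₗ-zeroˡ 0ᴹ)) ≈ᴹ-refl) (≈ᴹ-trans ([]-*ˡ _ _ _) (*ₗ-zeroˡ _))

    []-zeroʳ : ∀ x → [ x , 0ᴹ ] ≈ᴹ 0ᴹ
    []-zeroʳ x = ≈ᴹ-trans ([]-cong ≈ᴹ-refl (≈ᴹ-sym (*ₗ-zeroˡ 0ᴹ))) (≈ᴹ-trans ([]-*ʳ _ _ _) (*ₗ-zeroˡ _))

  module _ {g ℓg b ℓb : Level} (G : Group g ℓg) (L : LieAlgebra K b ℓb)
           (f : LinearMap K (LieAlgebra.vectorSpace (groupLieAlgebra K G)) (LieAlgebra.vectorSpace L)) where
    private
      module KG = LieAlgebra (groupLieAlgebra K G)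
      module L = LieAlgebra L
      module f = LinearMap f
      open SetoidReasoning L.≈ᴹ-setoid

      Preserves : (s t : KG.Carrierᴹ) → Set ℓb
      Preserves s t = f ⟨$⟩ KG.[ s , t ] L.≈ᴹ L.[ f ⟨$⟩ s , f ⟨$⟩ t ]

    -- Both sides are bilinear in `s` and `t`: `homoʳ` extends the second argument while the first
    -- is a group element, then `homo` extends the first.
    []-homo-ext : (∀ x y → Preserves (gen x) (gen y)) → ∀ s t → Preserves s t
    []-homo-ext p = homo
      where
      homoʳ : ∀ x t → Preserves (gen x) t
      homoʳ x (gen y) = p x y
      homoʳ x 𝟘       = begin
        f ⟨$⟩ KG.[ gen x , 𝟘 ]             ≈⟨ f.⟦⟧-cong ([]-zeroʳ (groupLieAlgebra K G) (gen x)) ⟩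
        f ⟨$⟩ 𝟘                            ≈⟨ f.0ᴹ-homo ⟩
        L.0ᴹ                               ≈⟨ []-zeroʳ L _ ⟨
        L.[ f ⟨$⟩ gen x , L.0ᴹ ]           ≈⟨ L.[]-cong L.≈ᴹ-refl f.0ᴹ-homo ⟨
        L.[ f ⟨$⟩ gen x , f ⟨$⟩ 𝟘 ]        ∎
      homoʳ x (t ⊹ u) = begin
        f ⟨$⟩ KG.[ gen x , t ⊹ u ]                                      ≈⟨ f.⟦⟧-cong (KG.[]-+ʳ (gen x) t u) ⟩
        f ⟨$⟩ (KG.[ gen x , t ] ⊹ KG.[ gen x , u ])                     ≈⟨ f.+ᴹ-homo _ _ ⟩
        f ⟨$⟩ KG.[ gen x , t ] L.+ᴹ f ⟨$⟩ KG.[ gen x , u ]              ≈⟨ L.+ᴹ-cong (homoʳ x t) (homoʳ x u) ⟩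
        L.[ f ⟨$⟩ gen x , f ⟨$⟩ t ] L.+ᴹ L.[ f ⟨$⟩ gen x , f ⟨$⟩ u ]    ≈⟨ L.[]-+ʳ _ _ _ ⟨
        L.[ f ⟨$⟩ gen x , f ⟨$⟩ t L.+ᴹ f ⟨$⟩ u ]                        ≈⟨ L.[]-cong L.≈ᴹ-refl (f.+ᴹ-homo t u) ⟨
        L.[ f ⟨$⟩ gen x , f ⟨$⟩ (t ⊹ u) ]                               ∎
      homoʳ x (r · t) = begin
        f ⟨$⟩ KG.[ gen x , r · t ]             ≈⟨ f.⟦⟧-cong (KG.[]-*ʳ r (gen x) t) ⟩
        f ⟨$⟩ (r · KG.[ gen x , t ])           ≈⟨ f.*ₗ-homo r _ ⟩
        r L.*ₗ f ⟨$⟩ KG.[ gen x , t ]          ≈⟨ L.*ₗ-congˡ (homoʳ x t) ⟩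
        r L.*ₗ L.[ f ⟨$⟩ gen x , f ⟨$⟩ t ]     ≈⟨ L.[]-*ʳ r _ _ ⟨
        L.[ f ⟨$⟩ gen x , r L.*ₗ f ⟨$⟩ t ]     ≈⟨ L.[]-cong L.≈ᴹ-refl (f.*ₗ-homo r t) ⟨
        L.[ f ⟨$⟩ gen x , f ⟨$⟩ (r · t) ]      ∎

      homo : ∀ s t → Preserves s t
      homo (gen x) t = homoʳ x t
      homo 𝟘       t = begin
        f ⟨$⟩ KG.[ 𝟘 , t ]                 ≈⟨ f.⟦⟧-cong ([]-zeroˡ (groupLieAlgebra K G) t) ⟩
        f ⟨$⟩ 𝟘                            ≈⟨ f.0ᴹ-homo ⟩
        L.0ᴹ                               ≈⟨ []-zeroˡ L _ ⟨
        L.[ L.0ᴹ , f ⟨$⟩ t ]               ≈⟨ L.[]-cong f.0ᴹ-homo L.≈ᴹ-refl ⟨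
        L.[ f ⟨$⟩ 𝟘 , f ⟨$⟩ t ]            ∎
      homo (s ⊹ u) t = begin
        f ⟨$⟩ KG.[ s ⊹ u , t ]                                      ≈⟨ f.⟦⟧-cong (KG.[]-+ˡ s u t) ⟩
        f ⟨$⟩ (KG.[ s , t ] ⊹ KG.[ u , t ])                         ≈⟨ f.+ᴹ-homo _ _ ⟩
        f ⟨$⟩ KG.[ s , t ] L.+ᴹ f ⟨$⟩ KG.[ u , t ]                  ≈⟨ L.+ᴹ-cong (homo s t) (homo u t) ⟩
        L.[ f ⟨$⟩ s , f ⟨$⟩ t ] L.+ᴹ L.[ f ⟨$⟩ u , f ⟨$⟩ t ]        ≈⟨ L.[]-+ˡ _ _ _ ⟨
        L.[ f ⟨$⟩ s L.+ᴹ f ⟨$⟩ u , f ⟨$⟩ t ]                        ≈⟨ L.[]-cong (f.+ᴹ-homo s u) L.≈ᴹ-refl ⟨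
        L.[ f ⟨$⟩ (s ⊹ u) , f ⟨$⟩ t ]                               ∎
      homo (r · s) t = begin
        f ⟨$⟩ KG.[ r · s , t ]             ≈⟨ f.⟦⟧-cong (KG.[]-*ˡ r s t) ⟩
        f ⟨$⟩ (r · KG.[ s , t ])           ≈⟨ f.*ₗ-homo r _ ⟩
        r L.*ₗ f ⟨$⟩ KG.[ s , t ]          ≈⟨ L.*ₗ-congˡ (homo s t) ⟩
        r L.*ₗ L.[ f ⟨$⟩ s , f ⟨$⟩ t ]     ≈⟨ L.[]-*ˡ r _ _ ⟨
        L.[ r L.*ₗ f ⟨$⟩ s , f ⟨$⟩ t ]     ≈⟨ L.[]-cong (f.*ₗ-homo r s) L.≈ᴹ-refl ⟨
        L.[ f ⟨$⟩ (r · s) , f ⟨$⟩ t ]      ∎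

  -- Composites of the induced maps on an exterior power.

  module _ {v ℓv : Level} {V : VectorSpace K v ℓv} (m : ℕ) where
    private
      module W = LeftModule (⋀ K V m)
      open InducedMaps K using (step; wedge-≗)
      open LeftModule (End K (⋀ K V m)) using () renaming (_≈ᴹ_ to _≈_; _+ᴹ_ to _+_)
      open RawMonoid (End-rawMonoid K V) using () renaming (_∙_ to _∘ⱽ_)
      open RawMonoid (End-rawMonoid K (⋀ K V m)) using (_∙_)
      open SumProperties W.+ᴹ-commutativeMonoid using (sum; sum-cong-≋)
      open SetoidReasoning W.≈ᴹ-setoid

      Δ D : LinearMap K V V → LinearMap K (⋀ K V m) (⋀ K V m)
      Δ T = diagonalMap K T m
      D T = derivationMap K T m

      twoSteps : (S T : LinearMap K V V) → Vector (LeftModule.Carrierᴹ V) m → Fin m → Fin m → W.Carrierᴹ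
      twoSteps S T w p q = gen (step S m q (step T m p w))

      -- `D S` distributes over the sum of wedges that `D T` produces, and its value on each of them
      -- is the inner sum by definition.
      D-∙-gen : ∀ S T w → (D S ∙ D T) ⟨$⟩ gen w W.≈ᴹ sum (λ p → sum (twoSteps S T w p))
      D-∙-gen S T w = sum-homo (D S) (λ p → gen (step T m p w))

      -- Updating one factor by `T` and then by `S` is a single update by the composite, so only
      -- diagonal terms occur.
      D-∘-gen : ∀ S T w → D (S ∘ⱽ T) ⟨$⟩ gen w W.≈ᴹ sum (λ p → twoSteps S T w p p)
      D-∘-gen S T w = sum-cong-≋ (λ p → W.≈ᴹ-sym (wedge-≗ S m (updateAt-updateAt p w)))

    diagonalMap-∘ : ∀ S T → Δ (S ∘ⱽ T) ≈ Δ S ∙ Δ T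
    diagonalMap-∘ S T = linear-ext (Δ (S ∘ⱽ T)) (Δ S ∙ Δ T) (λ _ → W.≈ᴹ-refl)

    -- D S ∙ D T − D T ∙ D S ≈ D (S ∘ T) − D (T ∘ S), with both sides moved so that it becomes
    -- an identity of sums of wedges in a commutative monoid.
    derivationMap-∘ : ∀ S T → D S ∙ D T + D (T ∘ⱽ S) ≈ D T ∙ D S + D (S ∘ⱽ T)
    derivationMap-∘ S T = linear-ext (D S ∙ D T + D (T ∘ⱽ S)) (D T ∙ D S + D (S ∘ⱽ T)) λ w → begin
      (D S ∙ D T) ⟨$⟩ gen w W.+ᴹ D (T ∘ⱽ S) ⟨$⟩ gen w
        ≈⟨ W.+ᴹ-cong (D-∙-gen S T w) (D-∘-gen T S w) ⟩
      sum (λ p → sum (twoSteps S T w p)) W.+ᴹ sum (λ p → twoSteps T S w p p)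
        -- Updates of distinct factors commute, which matches the off-diagonal terms; the diagonals
        -- left over are the two composites.
        ≈⟨ ∑∑-swap-diagonal W.+ᴹ-commutativeMonoid (twoSteps S T w) (twoSteps T S w)
             (λ p q q≢p → wedge-≗ S m (updateAt-commutes q p q≢p w)) ⟩
      sum (λ p → sum (twoSteps T S w p)) W.+ᴹ sum (λ p → twoSteps S T w p p)
        ≈⟨ W.+ᴹ-cong (D-∙-gen T S w) (D-∘-gen S T w) ⟨
      (D T ∙ D S) ⟨$⟩ gen w W.+ᴹ D (S ∘ⱽ T) ⟨$⟩ gen w
        ∎

  -- `𝒢` and `𝒜` preserve brackets.

  module _ {g ℓg v ℓv : Level} {G : Group g ℓg} {V : VectorSpace K v ℓv} (R : Representation K G V) (m : ℕ) where
    private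
      open Representation R
      module G = Group G
      module W = LeftModule (⋀ K V m)
      module KG = LieAlgebra (groupLieAlgebra K G)
      module E = LieAlgebra (endomorphismLieAlgebra (⋀ K V m))
      open RawMonoid (End-rawMonoid K V) using () renaming (_∙_ to _∘ⱽ_)
      open SetoidReasoning W.≈ᴹ-setoid

      𝓖 𝓐 : LinearMap K KG.vectorSpace E.vectorSpace
      𝓖 = 𝒢 K R m
      𝓐 = 𝒜 K R m

      Δ D : LinearMap K V V → LinearMap K (⋀ K V m) (⋀ K V m)
      Δ T = diagonalMap K T m
      D T = derivationMap K T m

      Δ-homo : ∀ x y u → Δ (ρ (x G.∙ y)) ⟨$⟩ u W.≈ᴹ Δ (ρ x) ⟨$⟩ Δ (ρ y) ⟨$⟩ u
      Δ-homo x y u = W.≈ᴹ-trans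
        (diagonalMap-cong K {S = ρ (x G.∙ y)} {T = ρ x ∘ⱽ ρ y} m (homo x y) u)
        (diagonalMap-∘ m (ρ x) (ρ y) u)

      D-homo : ∀ x y u → D (ρ (x G.∙ y)) ⟨$⟩ u W.≈ᴹ D (ρ x ∘ⱽ ρ y) ⟨$⟩ u
      D-homo x y = derivationMap-cong K {S = ρ (x G.∙ y)} {T = ρ x ∘ⱽ ρ y} m (homo x y)

    𝒢-[] : ∀ s t → 𝓖 ⟨$⟩ KG.[ s , t ] E.≈ᴹ E.[ 𝓖 ⟨$⟩ s , 𝓖 ⟨$⟩ t ]
    𝒢-[] = []-homo-ext G (endomorphismLieAlgebra (⋀ K V m)) 𝓖 λ x y u → begin
      (𝓖 ⟨$⟩ KG.[ gen x , gen y ]) ⟨$⟩ u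
        -- The product of two generators computes to a generator, so only the minus sign has to be
        -- carried through `𝓖`.
        ≈⟨ W.+ᴹ-congˡ (LinearMap.-ᴹ-homo 𝓖 (gen (y G.∙ x)) u) ⟩
      Δ (ρ (x G.∙ y)) ⟨$⟩ u W.+ᴹ W.-ᴹ (Δ (ρ (y G.∙ x)) ⟨$⟩ u)
        ≈⟨ W.+ᴹ-cong (Δ-homo x y u) (W.-ᴹ‿cong (Δ-homo y x u)) ⟩
      E.[ 𝓖 ⟨$⟩ gen x , 𝓖 ⟨$⟩ gen y ] ⟨$⟩ u
        ∎

    -- `𝒜` is not multiplicative in general; the cross terms cancel only in the commutator. This is
    -- why `[]-homo-ext` extends brackets rather than products.
    𝒜-[] : ∀ s t → 𝓐 ⟨$⟩ KG.[ s , t ] E.≈ᴹ E.[ 𝓐 ⟨$⟩ s , 𝓐 ⟨$⟩ t ]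
    𝒜-[] = []-homo-ext G (endomorphismLieAlgebra (⋀ K V m)) 𝓐 λ x y u → begin
      (𝓐 ⟨$⟩ KG.[ gen x , gen y ]) ⟨$⟩ u
        ≈⟨ W.+ᴹ-congˡ (LinearMap.-ᴹ-homo 𝓐 (gen (y G.∙ x)) u) ⟩
      D (ρ (x G.∙ y)) ⟨$⟩ u W.+ᴹ W.-ᴹ (D (ρ (y G.∙ x)) ⟨$⟩ u)
        ≈⟨ W.+ᴹ-cong (D-homo x y u) (W.-ᴹ‿cong (D-homo y x u)) ⟩
      D (ρ x ∘ⱽ ρ y) ⟨$⟩ u W.+ᴹ W.-ᴹ (D (ρ y ∘ⱽ ρ x) ⟨$⟩ u)
        ≈⟨ +-equation⇒minus-equation W.+ᴹ-abelianGroup (derivationMap-∘ m (ρ x) (ρ y) u) ⟩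
      E.[ 𝓐 ⟨$⟩ gen x , 𝓐 ⟨$⟩ gen y ] ⟨$⟩ u
        ∎

-- Closure properties of the set of Lie elements.

corollary6 : ∀ {c ℓ₁ ℓ₂ g ℓg v ℓv} (K : HeytingField c ℓ₁ ℓ₂) (G : Group g ℓg)
    (V : VectorSpace K v ℓv) (finite : FiniteDimensional K V)
    (R : Representation K G V) →
    IsLieSubalgebra K (groupLieAlgebra K G) (IsLieElement K R finite)
corollary6 K G V finite R = record
  -- Membership is one equality for each degree `m`, so every closure property is checked in a fixed
  -- degree.
  { respects  = λ p x∈ m m≤ → equalizer-respects K (𝒢 K R m) (𝒜 K R m) p (x∈ m m≤)
  ; 0-closed  = λ m m≤ → equalizer-0 K (𝒢 K R m) (𝒜 K R m)
  ; +-closed  = λ {x} {y} x∈ y∈ m m≤ → equalizer-+ K (𝒢 K R m) (𝒜 K R m) x y (x∈ m m≤) (y∈ m m≤)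
  ; *-closed  = λ r {x} x∈ m m≤ → equalizer-* K (𝒢 K R m) (𝒜 K R m) r x (x∈ m m≤)
  -- The bracket is moved into the endomorphism algebra, where `x∈` and `y∈` replace both entries,
  -- and is then moved back through `𝒜`.
  ; []-closed = λ {x} {y} x∈ y∈ m m≤ →
      let open LinearMap using (_⟨$⟩_)
          open LieAlgebra (groupLieAlgebra K G) using () renaming ([_,_] to [_,_]ᴳ)
          open LieAlgebra (endomorphismLieAlgebra K (⋀ K V m))
          open SetoidReasoning ≈ᴹ-setoid
      in begin
        𝒢 K R m ⟨$⟩ [ x , y ]ᴳ
          ≈⟨ 𝒢-[] K R m x y ⟩
        [ 𝒢 K R m ⟨$⟩ x , 𝒢 K R m ⟨$⟩ y ]
          ≈⟨ []-cong {𝒢 K R m ⟨$⟩ x} {𝒜 K R m ⟨$⟩ x} {𝒢 K R m ⟨$⟩ y} {𝒜 K R m ⟨$⟩ y}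
                     (x∈ m m≤) (y∈ m m≤) ⟩
        [ 𝒜 K R m ⟨$⟩ x , 𝒜 K R m ⟨$⟩ y ]
          ≈⟨ 𝒜-[] K R m x y ⟨
        𝒜 K R m ⟨$⟩ [ x , y ]ᴳ
          ∎
  }
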